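{- Let $F\subseteq\omega$ be a $\Pi^1_1$ set. Then there exists a computable function $g$ such that for every $p\in\omega$, $g(p)$ is an $\iota$-index of a c.e. effective quasi-Polish space $X=\iota(g(p))$ such that $X$ is metrizable if $p\in F$, and $X$ is not $T_1$ if $p\notin F$.
   Context: Let $(W_n)$ be a standard numbering of c.e. subsets of $\omega$, $V_n=\{(i,j)\mid\langle i,j\rangle\in W_n\}$, and $t$ a computable function with $V_{t(n)}$ the transitive closure of $V_n$. For a transitive relation $\prec$ on $\omega$, an ideal is a non-empty lower, directed subset of $\omega$; $\mathcal{I}(\prec)$ is the space of ideals with topology generated by $[k]_\prec=\{I\mid k\in I\}$, an effective space with basic opens numbered by $k$. The numbering $\iota$ is defined by $\iota(n)=\mathcal{I}(V_{t(n)})$; an $\iota$-index of $X$ is an $n$ with $X=\iota(n)$. Every $\iota(n)$ is an effective quasi-Polish space; it is c.e. (overt) if $\{k\mid[k]_{V_{t(n)}}\neq\emptyset\}$ is c.e. -}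

module Defs where

open import Data.List.Base using (List)
open import Data.List.Relation.Unary.All using (All)
open import Data.Nat.Base as ℕ using (ℕ; zero; suc)
open import Data.Product.Base using (Σ; ∃-syntax; _×_; _,_; proj₁; proj₂)
open import Data.Rational.Base as ℚ using (ℚ; 0ℚ; 1ℚ)
import Data.Rational.Properties as ℚ
open import Function.Base using (_∘_)
open import Function.Bundles using (_⇔_)
open import Level using (Level; 0ℓ) renaming (suc to lsuc)
open import Relation.Binary.Bundles using (Setoid)
import Relation.Binary.Core as Rel
open import Relation.Binary.Construct.Closure.Transitive using (TransClosure)
open import Relation.Binary.Definitions using (_Respects_; tri<; tri≈; tri>)
open import Relation.Binary.PropositionalEquality
  using (_≡_; refl; sym; trans; cong; subst; module ≡-Reasoning)
open import Relation.Nullary.Negation.Core using (¬_; contradiction)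
open import Relation.Unary using (Pred; _∈_; _∉_; _⊆_; _≐_)

private
  variable
    ℓ : Level

-- Cantor pairing: ⟨ i , j ⟩ = (i + j)(i + j + 1) / 2 + j.

triangle : ℕ → ℕ
triangle zero    = zero
triangle (suc n) = suc n ℕ.+ triangle n

⟨_,_⟩ : ℕ → ℕ → ℕ
⟨ i , j ⟩ = triangle (i ℕ.+ j) ℕ.+ j

-- The inverse of ⟨_,_⟩ walks along the antidiagonals.

unpair : ℕ → ℕ × ℕ
unpair zero    = zero , zero
unpair (suc n) with unpair n
... | zero  , j = suc j , zero
... | suc i , j = i , suc j

-- Programs for the unary partial recursive functions; functions of several
-- arguments take them paired.  `rec f g` is primitive recursion on the second
-- component and `min f` is unbounded minimisation.

data Code : Set where
  zero succ left right : Code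
  pair comp rec        : Code → Code → Code
  min                  : Code → Code

infix 4 _[_]⇓_

data _[_]⇓_ : Code → ℕ → ℕ → Set where
  zero⇓  : ∀ {x} → zero [ x ]⇓ 0
  succ⇓  : ∀ {x} → succ [ x ]⇓ suc x
  left⇓  : ∀ {x} → left [ x ]⇓ proj₁ (unpair x)
  right⇓ : ∀ {x} → right [ x ]⇓ proj₂ (unpair x)
  pair⇓  : ∀ {f g x y z} → f [ x ]⇓ y → g [ x ]⇓ z → pair f g [ x ]⇓ ⟨ y , z ⟩
  comp⇓  : ∀ {f g x y z} → g [ x ]⇓ y → f [ y ]⇓ z → comp f g [ x ]⇓ z
  rec⇓₀  : ∀ {f g a y} → f [ a ]⇓ y → rec f g [ ⟨ a , 0 ⟩ ]⇓ y
  rec⇓₊  : ∀ {f g a n y z} → rec f g [ ⟨ a , n ⟩ ]⇓ y →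
           g [ ⟨ a , ⟨ n , y ⟩ ⟩ ]⇓ z → rec f g [ ⟨ a , suc n ⟩ ]⇓ z
  min⇓   : ∀ {f a n} → f [ ⟨ a , n ⟩ ]⇓ 0 →
           (∀ m → m ℕ.< n → ∃[ y ] f [ ⟨ a , m ⟩ ]⇓ suc y) → min f [ a ]⇓ n

Computable : (ℕ → ℕ) → Set
Computable f = ∃[ c ] ∀ n → c [ n ]⇓ f n

dom : Code → Pred ℕ 0ℓ
dom c x = ∃[ y ] c [ x ]⇓ y

CE : Pred ℕ ℓ → Set ℓ
CE P = ∃[ c ] P ≐ dom c

encode : Code → ℕ
encode zero       = ⟨ 0 , 0 ⟩
encode succ       = ⟨ 1 , 0 ⟩
encode left       = ⟨ 2 , 0 ⟩
encode right      = ⟨ 3 , 0 ⟩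
encode (pair f g) = ⟨ 4 , ⟨ encode f , encode g ⟩ ⟩
encode (comp f g) = ⟨ 5 , ⟨ encode f , encode g ⟩ ⟩
encode (rec f g)  = ⟨ 6 , ⟨ encode f , encode g ⟩ ⟩
encode (min f)    = ⟨ 7 , encode f ⟩

-- A number that encodes no program indexes the empty set.

kleene : ℕ → Pred ℕ 0ℓ
kleene n x = ∃[ c ] encode c ≡ n × x ∈ dom c

_≤ₙ_ : Rel.Rel (ℕ → Pred ℕ 0ℓ) 0ℓ
W ≤ₙ W′ = ∃[ h ] Computable h × (∀ n → W n ≐ W′ (h n))

-- A standard numbering is one that is acceptable in the sense of Rogers.

IsStandard : Pred (ℕ → Pred ℕ 0ℓ) 0ℓ
IsStandard W = (W ≤ₙ kleene) × (kleene ≤ₙ W)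

V : (ℕ → Pred ℕ 0ℓ) → ℕ → Rel.Rel ℕ 0ℓ
V W n i j = ⟨ i , j ⟩ ∈ W n

IsTransitiveClosureMap : (ℕ → Pred ℕ 0ℓ) → Pred (ℕ → ℕ) 0ℓ
IsTransitiveClosureMap W t = ∀ n → V W (t n) Rel.⇔ TransClosure (V W n)

-- f ↾ n codes the string f 0, …, f (n - 1).  The last entry is outermost, and
-- every natural number codes exactly one string.

infix 8 _↾_

_↾_ : (ℕ → ℕ) → ℕ → ℕ
f ↾ zero  = 0
f ↾ suc n = suc ⟨ f n , f ↾ n ⟩

-- The effectively open subset of ω × ω^ω given by a c.e. set A: the union of
-- the basic open sets {p} × [σ] with ⟨ p , σ ⟩ ∈ A.

EffectiveOpen : Pred ℕ 0ℓ → ℕ → Pred (ℕ → ℕ) 0ℓ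
EffectiveOpen A p f = ∃[ n ] ⟨ p , f ↾ n ⟩ ∈ A

Π¹₁ : Pred ℕ 0ℓ → Set₁
Π¹₁ F = ∃[ A ] CE A × F ≐ (λ p → ∀ f → f ∈ EffectiveOpen A p)

-- Dedekind reals, given by their lower cuts.

record ℝ : Set₁ where
  field
    cut       : Pred ℚ 0ℓ
    inhabited : ∃[ q ] q ∈ cut
    proper    : ∃[ q ] q ∉ cut
    lower     : ∀ {p q} → p ℚ.< q → q ∈ cut → p ∈ cut
    open′     : ∀ {p} → p ∈ cut → ∃[ q ] p ℚ.< q × q ∈ cut

open ℝ

infix 4 _≃ᵣ_ _≤ᵣ_ _<ᵣ_
infixl 6 _+ᵣ_

_≃ᵣ_ : Rel.Rel ℝ 0ℓ
x ≃ᵣ y = cut x ≐ cut y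

_≤ᵣ_ : Rel.Rel ℝ 0ℓ
x ≤ᵣ y = cut x ⊆ cut y

_<ᵣ_ : Rel.Rel ℝ 0ℓ
x <ᵣ y = ∃[ q ] q ∉ cut x × q ∈ cut y

private
  p+[q-p] : ∀ p q → p ℚ.+ (q ℚ.- p) ≡ q
  p+[q-p] p q = begin
    p ℚ.+ (q ℚ.- p)    ≡⟨ ℚ.+-comm p (q ℚ.- p) ⟩
    q ℚ.- p ℚ.+ p      ≡⟨ ℚ.+-assoc q (ℚ.- p) p ⟩
    q ℚ.+ (ℚ.- p ℚ.+ p) ≡⟨ cong (q ℚ.+_) (ℚ.+-inverseˡ p) ⟩
    q ℚ.+ 0ℚ           ≡⟨ ℚ.+-identityʳ q ⟩
    q                  ∎
    where open ≡-Reasoning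

  p+q-p : ∀ p q → p ℚ.+ q ℚ.- p ≡ q
  p+q-p p q = trans (ℚ.+-assoc p q (ℚ.- p))
    (p+[q-p] p q)

  below : ∀ x {p q} → p ∈ cut x → q ∉ cut x → p ℚ.< q
  below x {p} {q} p∈ q∉ with ℚ.<-cmp p q
  ... | tri< p<q _ _  = p<q
  ... | tri≈ _ refl _ = contradiction p∈ q∉
  ... | tri> _ _ q<p  = contradiction (lower x q<p p∈) q∉

_+ᵣ_ : ℝ → ℝ → ℝ
cut       (x +ᵣ y) r = ∃[ p ] ∃[ q ] p ∈ cut x × q ∈ cut y × r ≡ p ℚ.+ q
inhabited (x +ᵣ y) with inhabited x | inhabited y
... | p , p∈ | q , q∈ = p ℚ.+ q , p , q , p∈ , q∈ , refl
proper    (x +ᵣ y) with proper x | proper y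
... | p , p∉ | q , q∉ = p ℚ.+ q , λ where
  (a , b , a∈ , b∈ , eq) →
    ℚ.<-irrefl (sym eq) (ℚ.+-mono-< (below x a∈ p∉) (below y b∈ q∉))
lower     (x +ᵣ y) {r} r<s (p , q , p∈ , q∈ , refl) =
  p , r ℚ.- p , p∈ ,
  lower y (subst (r ℚ.- p ℚ.<_) (p+q-p p q) (ℚ.+-monoˡ-< (ℚ.- p) r<s)) q∈ ,
  sym (p+[q-p] p r)
open′     (x +ᵣ y) (p , q , p∈ , q∈ , refl) with open′ x p∈
... | p′ , p<p′ , p′∈ =
  p′ ℚ.+ q , ℚ.+-monoˡ-< q p<p′ , p′ , q , p′∈ , q∈ , refl

0ᵣ : ℝ
cut       0ᵣ = ℚ._< 0ℚ
inhabited 0ᵣ = ℚ.- 1ℚ , ℚ.negative⁻¹ (ℚ.- 1ℚ)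
proper    0ᵣ = 0ℚ , ℚ.<-irrefl refl
lower     0ᵣ = ℚ.<-trans
open′     0ᵣ p<0 with ℚ.<-dense p<0
... | q , p<q , q<0 = q , p<q , q<0

-- A set of points, up to _≈_, with a numbered subbasis of its topology.

record EffectiveSpace : Set₂ where
  field
    points     : Setoid (lsuc 0ℓ) 0ℓ
  open Setoid points public
  field
    basic      : ℕ → Pred Carrier 0ℓ
    basic-resp : ∀ k → basic k Respects _≈_

  Open : Pred (Pred Carrier (lsuc 0ℓ)) (lsuc 0ℓ)
  Open U = ∀ {x} → x ∈ U → Σ (List ℕ) λ ks → All (λ k → x ∈ basic k) ks ×
           (∀ {y} → All (λ k → y ∈ basic k) ks → y ∈ U)

module _ (X : EffectiveSpace) where
  open EffectiveSpace X

  Overt : Set₁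
  Overt = CE (λ k → ∃[ x ] x ∈ basic k)

  T₁ : Set₂
  T₁ = ∀ x y → ¬ (x ≈ y) → ∃[ U ] Open U × x ∈ U × y ∉ U

  record IsMetric (d : Carrier → Carrier → ℝ) : Set₁ where
    field
      nonneg     : ∀ x y → 0ᵣ ≤ᵣ d x y
      zero⇔≈     : ∀ x y → (d x y ≃ᵣ 0ᵣ) ⇔ (x ≈ y)
      symmetry   : ∀ x y → d x y ≃ᵣ d y x
      triangular : ∀ x y z → d x z ≤ᵣ d x y +ᵣ d y z

  MetricOpen : (Carrier → Carrier → ℝ) → Pred (Pred Carrier (lsuc 0ℓ)) (lsuc 0ℓ)
  MetricOpen d U = ∀ {x} → x ∈ U →
    ∃[ ε ] 0ᵣ <ᵣ ε × (∀ {y} → d x y <ᵣ ε → y ∈ U)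

  Metrizable : Set₂
  Metrizable = ∃[ d ] IsMetric d × (∀ U → Open U ⇔ MetricOpen d U)

record Ideal (_≺_ : Rel.Rel ℕ 0ℓ) : Set₁ where
  field
    members  : Pred ℕ 0ℓ
    nonempty : ∃[ k ] k ∈ members
    lower    : ∀ {i j} → i ≺ j → j ∈ members → i ∈ members
    directed : ∀ {i j} → i ∈ members → j ∈ members →
               ∃[ k ] k ∈ members × i ≺ k × j ≺ k

idealSpace : Rel.Rel ℕ 0ℓ → EffectiveSpace
idealSpace _≺_ = record
  { points = record
    { Carrier       = Ideal _≺_
    ; _≈_           = λ I J → members I ≐ members J
    ; isEquivalence = record
      { refl  = (λ k∈ → k∈) , (λ k∈ → k∈)
      ; sym   = λ (I⊆J , J⊆I) → J⊆I , I⊆J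
      ; trans = λ (I⊆J , J⊆I) (J⊆K , K⊆J) → J⊆K ∘ I⊆J , J⊆I ∘ K⊆J
      }
    }
  ; basic      = λ k I → k ∈ members I
  ; basic-resp = λ k (I⊆J , _) → I⊆J
  }
  where open Ideal

ι : (ℕ → Pred ℕ 0ℓ) → (ℕ → ℕ) → ℕ → EffectiveSpace
ι W t n = idealSpace (V W (t n))

{-# OPTIONS --safe #-}
-- Let A be a c.e. set such that p ∈ F iff every f : ω → ω has a prefix σ with
-- ⟨ p , σ ⟩ ∈ A.  Take as elements the strings with a label in ω, where label 0
-- is distinguished, and order them by proper extension, with the restriction
-- that a label i > 0 may be followed by the label 0 only after A has been met.
-- A path f with a prefix in A carries exactly one ideal, while a path without
-- one carries the ideal of all elements over f and, strictly inside it, the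
-- ideal of those with label 0.  So for p ∈ F the space is a copy of Baire space,
-- whose basic open sets are clopen, and for p ∉ F two distinct points are
-- comparable in the specialisation order.  Every element lies in an ideal, hence
-- all the spaces are overt.
--
-- The label i itself names the prefix which is claimed to be in A (the string
-- without its last i entries); thus the one-step relation is c.e. without any
-- dovetailing, and t supplies its transitive closure.
module Submission where

open import Defs
open import Axiom.ExcludedMiddle using (ExcludedMiddle)
import Data.Integer.Base as ℤ
import Data.Integer.Properties as ℤ
open import Data.List.Base using (List; []; _∷_; _++_)
open import Data.List.Relation.Unary.All as All using (All; []; _∷_)
import Data.List.Relation.Unary.All.Properties as All
open import Data.Nat.Base
  using (ℕ; zero; suc; pred; _+_; _∸_; _≤_; _<_; _⊔_; z≤n; s≤s)
open import Data.Nat.Coprimality using (1-coprimeTo)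
open import Data.Nat.GeneralisedArithmetic using (fold)
open import Data.Nat.Induction using (<-rec)
import Data.Nat.Properties as ℕ
open import Data.Product.Base
  using (Σ-syntax; ∃-syntax; ∃₂; _×_; _,_; proj₁; proj₂)
open import Data.Product.Properties using (,-injectiveˡ; ,-injectiveʳ)
open import Data.Rational.Base as ℚ using (ℚ; mkℚ; 0ℚ; 1ℚ; *<*; *≤*)
import Data.Rational.Properties as ℚ
open import Data.Sum.Base as Sum using (_⊎_; inj₁; inj₂; swap)
open import Function.Base using (_∘_; id)
open import Function.Bundles using (_⇔_; mk⇔; module Equivalence)
open import Level using (0ℓ)
import Relation.Binary.Core as Rel
open import Relation.Binary.Construct.Closure.Transitive
  using (TransClosure; [_]; _∷_; _∷ʳ_)
open import Relation.Binary.Definitions using (tri<; tri≈; tri>)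
open import Relation.Binary.PropositionalEquality
  using (_≡_; refl; sym; trans; cong; cong₂; subst; module ≡-Reasoning)
open import Relation.Nullary.Decidable.Core using (yes; no; decidable-stable)
open import Relation.Nullary.Negation.Core using (¬_; contradiction)
open import Relation.Unary using (Pred; _∈_; _∉_; _≐_; _∩_)
open import Relation.Unary.Properties using (≐-sym; ≐-trans)

-- Computability

π₁ π₂ : ℕ → ℕ
π₁ = proj₁ ∘ unpair
π₂ = proj₂ ∘ unpair

next : ℕ × ℕ → ℕ × ℕ
next (zero  , j) = suc j , zero
next (suc i , j) = i , suc j

unpair-suc : ∀ n → unpair (suc n) ≡ next (unpair n)
unpair-suc n with unpair n
... | zero  , _ = refl
... | suc _ , _ = refl

⟨zero,⟩-suc : ∀ j → ⟨ suc j , 0 ⟩ ≡ suc ⟨ 0 , j ⟩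
⟨zero,⟩-suc j = begin
  triangle (suc (j + 0)) + 0 ≡⟨ ℕ.+-identityʳ _ ⟩
  triangle (suc (j + 0))     ≡⟨ cong (triangle ∘ suc) (ℕ.+-identityʳ j) ⟩
  suc (j + triangle j)       ≡⟨ cong suc (ℕ.+-comm j (triangle j)) ⟩
  suc (triangle j + j)       ∎
  where open ≡-Reasoning

⟨suc,⟩-suc : ∀ i j → ⟨ i , suc j ⟩ ≡ suc ⟨ suc i , j ⟩
⟨suc,⟩-suc i j = trans (ℕ.+-suc _ j) (cong (λ s → suc (triangle s + j)) (ℕ.+-suc i j))

⟨next⟩ : ∀ x → ⟨ proj₁ (next x) , proj₂ (next x) ⟩ ≡ suc ⟨ proj₁ x , proj₂ x ⟩
⟨next⟩ (zero  , j) = ⟨zero,⟩-suc j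
⟨next⟩ (suc i , j) = ⟨suc,⟩-suc i j

pair-unpair : ∀ n → ⟨ π₁ n , π₂ n ⟩ ≡ n
pair-unpair zero    = refl
pair-unpair (suc n) rewrite unpair-suc n =
  trans (⟨next⟩ (unpair n)) (cong suc (pair-unpair n))

-- Induction along the walk of `unpair`: a pair with `suc j` comes just after one on the same
-- antidiagonal, and `(suc i , 0)` starts a new antidiagonal after `(0 , i)`.
unpair-pair : ∀ i j → unpair ⟨ i , j ⟩ ≡ (i , j)
unpair-pair i j = on-antidiagonal (i + j) i j refl
  where
  on-antidiagonal : ∀ s i j → i + j ≡ s → unpair ⟨ i , j ⟩ ≡ (i , j)
  on-antidiagonal s i (suc j) eq = begin
    unpair ⟨ i , suc j ⟩       ≡⟨ cong unpair (⟨suc,⟩-suc i j) ⟩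
    unpair (suc ⟨ suc i , j ⟩) ≡⟨ unpair-suc ⟨ suc i , j ⟩ ⟩
    next (unpair ⟨ suc i , j ⟩)
      ≡⟨ cong next (on-antidiagonal s (suc i) j (trans (sym (ℕ.+-suc i j)) eq)) ⟩
    i , suc j                  ∎
    where open ≡-Reasoning
  on-antidiagonal (suc s) (suc i) zero eq = begin
    unpair ⟨ suc i , 0 ⟩   ≡⟨ cong unpair (⟨zero,⟩-suc i) ⟩
    unpair (suc ⟨ 0 , i ⟩) ≡⟨ unpair-suc ⟨ 0 , i ⟩ ⟩
    next (unpair ⟨ 0 , i ⟩)
      ≡⟨ cong next (on-antidiagonal s 0 i
           (trans (sym (ℕ.+-identityʳ i)) (ℕ.suc-injective eq))) ⟩
    suc i , 0              ∎
    where open ≡-Reasoning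
  on-antidiagonal _ zero zero _ = refl

π₁-⟨⟩ : ∀ i j → π₁ ⟨ i , j ⟩ ≡ i
π₁-⟨⟩ i j = cong proj₁ (unpair-pair i j)

π₂-⟨⟩ : ∀ i j → π₂ ⟨ i , j ⟩ ≡ j
π₂-⟨⟩ i j = cong proj₂ (unpair-pair i j)

⟨⟩-injective : ∀ {i j i′ j′} → ⟨ i , j ⟩ ≡ ⟨ i′ , j′ ⟩ → i ≡ i′ × j ≡ j′
⟨⟩-injective {i} {j} {i′} {j′} eq = ,-injectiveˡ eq′ , ,-injectiveʳ eq′
  where eq′ = trans (sym (unpair-pair i j)) (trans (cong unpair eq) (unpair-pair i′ j′))

-- The inputs are linked by an equation because `⟨ a , n ⟩` is no constructor, so two derivations
-- for `rec` cannot be unified at one index.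
⇓-deterministic : ∀ {c x x′ y y′} → c [ x ]⇓ y → c [ x′ ]⇓ y′ → x ≡ x′ → y ≡ y′
⇓-deterministic zero⇓ zero⇓ _ = refl
⇓-deterministic succ⇓ succ⇓ refl = refl
⇓-deterministic left⇓ left⇓ refl = refl
⇓-deterministic right⇓ right⇓ refl = refl
⇓-deterministic (pair⇓ d e) (pair⇓ d′ e′) eq =
  cong₂ ⟨_,_⟩ (⇓-deterministic d d′ eq) (⇓-deterministic e e′ eq)
⇓-deterministic (comp⇓ d e) (comp⇓ d′ e′) eq =
  ⇓-deterministic e e′ (⇓-deterministic d d′ eq)
⇓-deterministic (rec⇓₀ {a = a} d) (rec⇓₀ {a = a′} d′) eq =
  ⇓-deterministic d d′ (proj₁ (⟨⟩-injective {a} {0} {a′} {0} eq))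
⇓-deterministic (rec⇓₀ {a = a} _) (rec⇓₊ {a = a′} _ _) eq
  with () ← proj₂ (⟨⟩-injective {a} {0} {a′} {suc _} eq)
⇓-deterministic (rec⇓₊ {a = a} _ _) (rec⇓₀ {a = a′} _) eq
  with () ← proj₂ (⟨⟩-injective {a} {_} {a′} {0} eq)
⇓-deterministic (rec⇓₊ {a = a} {n} d e) (rec⇓₊ {a = a′} {n′} d′ e′) eq
  with refl , refl ← ⟨⟩-injective {a} {suc n} {a′} {suc n′} eq =
  ⇓-deterministic e e′
    (cong (λ y → ⟨ a , ⟨ n , y ⟩ ⟩) (⇓-deterministic d d′ refl))
⇓-deterministic (min⇓ {n = n} d b) (min⇓ {n = n′} d′ b′) refl with ℕ.<-cmp n n′
-- At the smaller of two minima the program would return both zero and a successor.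
... | tri< n<n′ _ _ with () ← ⇓-deterministic d (proj₂ (b′ n n<n′)) refl
... | tri≈ _ n≡n′ _ = n≡n′
... | tri> _ _ n′<n with () ← ⇓-deterministic (proj₂ (b n′ n′<n)) d′ refl

height : Code → ℕ
height (pair f g) = suc (height f ⊔ height g)
height (comp f g) = suc (height f ⊔ height g)
height (rec f g)  = suc (height f ⊔ height g)
height (min f)    = suc (height f)
height _          = 0

-- The first argument is fuel, bounding the height of the program.
decode : ℕ → ℕ → Code
decode₂ : (Code → Code → Code) → ℕ → ℕ × ℕ → Code
decode-tagged : ℕ → ℕ × ℕ → Code

decode n x = decode-tagged n (unpair x)

decode₂ k n (x , y) = k (decode n x) (decode n y)

decode-tagged n       (0 , _) = zero
decode-tagged n       (1 , _) = succ
decode-tagged n       (2 , _) = left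
decode-tagged n       (3 , _) = right
decode-tagged (suc n) (4 , x) = decode₂ pair n (unpair x)
decode-tagged (suc n) (5 , x) = decode₂ comp n (unpair x)
decode-tagged (suc n) (6 , x) = decode₂ rec n (unpair x)
decode-tagged (suc n) (7 , x) = min (decode n x)
decode-tagged _       _       = zero

decode-encode : ∀ n c → height c ≤ n → decode n (encode c) ≡ c
decode₂-encode : ∀ k n f g → height f ⊔ height g ≤ n →
                 decode₂ k n (unpair ⟨ encode f , encode g ⟩) ≡ k f g

decode-encode n zero _ rewrite unpair-pair 0 0 = refl
decode-encode n succ _ rewrite unpair-pair 1 0 = refl
decode-encode n left _ rewrite unpair-pair 2 0 = refl
decode-encode n right _ rewrite unpair-pair 3 0 = refl
decode-encode (suc n) (pair f g) (s≤s h)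
  rewrite unpair-pair 4 ⟨ encode f , encode g ⟩ = decode₂-encode pair n f g h
decode-encode (suc n) (comp f g) (s≤s h)
  rewrite unpair-pair 5 ⟨ encode f , encode g ⟩ = decode₂-encode comp n f g h
decode-encode (suc n) (rec f g) (s≤s h)
  rewrite unpair-pair 6 ⟨ encode f , encode g ⟩ = decode₂-encode rec n f g h
decode-encode (suc n) (min f) (s≤s h)
  rewrite unpair-pair 7 (encode f) = cong min (decode-encode n f h)

decode₂-encode k n f g h rewrite unpair-pair (encode f) (encode g) =
  cong₂ k (decode-encode n f (ℕ.m⊔n≤o⇒m≤o (height f) (height g) h))
          (decode-encode n g (ℕ.m⊔n≤o⇒n≤o (height f) (height g) h))

-- With the larger height as common fuel, one decoder inverts `encode` on both programs.
encode-injective : ∀ {c c′} → encode c ≡ encode c′ → c ≡ c′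
encode-injective {c} {c′} eq = begin
  c                    ≡⟨ sym (decode-encode n c (ℕ.m≤m⊔n (height c) (height c′))) ⟩
  decode n (encode c)  ≡⟨ cong (decode n) eq ⟩
  decode n (encode c′) ≡⟨ decode-encode n c′ (ℕ.m≤n⊔m (height c) (height c′)) ⟩
  c′                   ∎
  where
  open ≡-Reasoning
  n = height c ⊔ height c′

kleene-encode : ∀ c → kleene (encode c) ≐ dom c
kleene-encode c =
  (λ (c′ , eq , x∈) → subst (λ c → _ ∈ dom c) (encode-injective eq) x∈) ,
  (λ x∈ → c , refl , x∈)

-- Computable functions and c.e. sets

Computable₂ : (ℕ → ℕ → ℕ) → Set
Computable₂ f = Computable (λ x → f (π₁ x) (π₂ x))

Computable-resp : ∀ {f g} → (∀ x → f x ≡ g x) → Computable f → Computable g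
Computable-resp f≗g (c , p) = c , λ x → subst (c [ x ]⇓_) (f≗g x) (p x)

suc-computable : Computable suc
suc-computable = succ , λ _ → succ⇓

π₁-computable : Computable π₁
π₁-computable = left , λ _ → left⇓

π₂-computable : Computable π₂
π₂-computable = right , λ _ → right⇓

∘-computable : ∀ {f g} → Computable f → Computable g → Computable (f ∘ g)
∘-computable (c , p) (d , q) = comp c d , λ x → comp⇓ (q x) (p _)

⟨⟩-computable : ∀ {f g} → Computable f → Computable g →
                Computable (λ x → ⟨ f x , g x ⟩)
⟨⟩-computable (c , p) (d , q) = pair c d , λ x → pair⇓ (p x) (q x)

-- `Code` has no identity program; splitting and re-pairing the input serves as one.
id-computable : Computable id
id-computable =
  Computable-resp pair-unpair (⟨⟩-computable π₁-computable π₂-computable)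

∘₂-computable : ∀ f {g h} → Computable₂ f → Computable g → Computable h →
                Computable (λ x → f (g x) (h x))
∘₂-computable f {g} {h} p q r =
  Computable-resp (λ x → cong₂ f (π₁-⟨⟩ (g x) (h x)) (π₂-⟨⟩ (g x) (h x)))
    (∘-computable p (⟨⟩-computable q r))

numeral : ℕ → Code
numeral = fold zero (comp succ)

numeral⇓ : ∀ n {x} → numeral n [ x ]⇓ n
numeral⇓ zero    = zero⇓
numeral⇓ (suc n) = comp⇓ (numeral⇓ n) succ⇓

const-computable : ∀ n → Computable (λ _ → n)
const-computable n = numeral n , λ _ → numeral⇓ n

primrec : (ℕ → ℕ) → (ℕ → ℕ) → ℕ → ℕ → ℕ
primrec f g a zero    = f a
primrec f g a (suc n) = g ⟨ a , ⟨ n , primrec f g a n ⟩ ⟩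

primrec-computable : ∀ {f g} → Computable f → Computable g → Computable₂ (primrec f g)
primrec-computable {f} {g} (c , p) (d , q) = rec c d , λ x →
  subst (λ z → rec c d [ z ]⇓ primrec f g (π₁ x) (π₂ x)) (pair-unpair x)
    (rec⇓ (π₁ x) (π₂ x))
  where
  rec⇓ : ∀ a n → rec c d [ ⟨ a , n ⟩ ]⇓ primrec f g a n
  rec⇓ a zero    = rec⇓₀ {a = a} (p a)
  rec⇓ a (suc n) = rec⇓₊ {a = a} (rec⇓ a n) (q _)

fold-computable : ∀ {f} → Computable f → Computable₂ (λ x n → fold x f n)
fold-computable {f} p =
  Computable-resp (λ x → primrec-fold (π₁ x) (π₂ x))
    (primrec-computable id-computable
      (∘-computable p (∘-computable π₂-computable π₂-computable)))
  where
  primrec-fold : ∀ a n → primrec id (f ∘ π₂ ∘ π₂) a n ≡ fold a f n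
  primrec-fold a zero    = refl
  primrec-fold a (suc n) = cong f (begin
    π₂ (π₂ ⟨ a , ⟨ n , r ⟩ ⟩) ≡⟨ cong π₂ (π₂-⟨⟩ a ⟨ n , r ⟩) ⟩
    π₂ ⟨ n , r ⟩              ≡⟨ π₂-⟨⟩ n r ⟩
    r                         ≡⟨ primrec-fold a n ⟩
    fold a f n                ∎)
    where
    open ≡-Reasoning
    r = primrec id (f ∘ π₂ ∘ π₂) a n

pred-computable : Computable pred
pred-computable =
  Computable-resp pred-primrec
    (∘₂-computable (primrec (λ _ → 0) (π₁ ∘ π₂)) (primrec-computable (const-computable 0)
        (∘-computable π₁-computable π₂-computable))
      (const-computable 0) id-computable)
  where
  pred-primrec : ∀ n → primrec (λ _ → 0) (π₁ ∘ π₂) 0 n ≡ pred n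
  pred-primrec zero    = refl
  pred-primrec (suc n) = trans (cong π₁ (π₂-⟨⟩ 0 ⟨ n , _ ⟩)) (π₁-⟨⟩ n _)

∸-computable : Computable₂ _∸_
∸-computable =
  Computable-resp (λ x → fold-pred (π₁ x) (π₂ x)) (fold-computable pred-computable)
  where
  fold-pred : ∀ m n → fold m pred n ≡ m ∸ n
  fold-pred m zero    = refl
  fold-pred m (suc n) = trans (cong pred (fold-pred m n)) (ℕ.pred[m∸n]≡m∸[1+n] m n)

CE-resp : {P Q : Pred ℕ 0ℓ} → P ≐ Q → CE P → CE Q
CE-resp (P⊆Q , Q⊆P) (c , P⊆c , c⊆P) = c , P⊆c ∘ Q⊆P , P⊆Q ∘ c⊆P

dom-comp : ∀ {f} c ((d , _) : Computable f) → (dom c ∘ f) ≐ dom (comp c d)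
dom-comp c (d , p) =
  (λ {x} (y , e) → y , comp⇓ (p x) e) ,
  (λ { {x} (y , comp⇓ e e′) →
         y , subst (λ z → c [ z ]⇓ y) (⇓-deterministic e (p x) refl) e′ })

CE-∘ : ∀ {P : Pred ℕ 0ℓ} {f} → CE P → Computable f → CE (P ∘ f)
CE-∘ {P} {f} (c , P⊆c , c⊆P) p =
  comp c (proj₁ p) , proj₁ (dom-comp c p) ∘ P⊆c {f _} , c⊆P ∘ proj₂ (dom-comp c p)

CE-∩ : {P Q : Pred ℕ 0ℓ} → CE P → CE Q → CE (P ∩ Q)
CE-∩ (c , P⊆c , c⊆P) (d , Q⊆d , d⊆Q) = pair c d ,
  (λ (x∈P , x∈Q) → _ , pair⇓ (proj₂ (P⊆c x∈P)) (proj₂ (Q⊆d x∈Q))) ,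
  (λ { (_ , pair⇓ e e′) → c⊆P (_ , e) , d⊆Q (_ , e′) })

-- The search tests its parameter and ignores the search variable, so it stops at once on zero and
-- never on other inputs.
CE-zero : CE (_≡ 0)
CE-zero = min left ,
  (λ { refl → 0 , min⇓ left⇓ (λ _ ()) }) ,
  (λ { {x} (n , min⇓ e _) →
         trans (sym (π₁-⟨⟩ x n)) (⇓-deterministic left⇓ e refl) })

CE-≡ : ∀ {f g} → Computable f → Computable g → CE (λ x → f x ≡ g x)
CE-≡ {f} {g} p q =
  CE-resp
    ( (λ (f≤g , g≤f) → ℕ.≤-antisym (ℕ.m∸n≡0⇒m≤n f≤g) (ℕ.m∸n≡0⇒m≤n g≤f))
    , (λ {x} f≡g → ℕ.m≤n⇒m∸n≡0 (ℕ.≤-reflexive f≡g) , ℕ.m≤n⇒m∸n≡0 (ℕ.≤-reflexive (sym f≡g))))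
    (CE-∩ (CE-∘ CE-zero (∘₂-computable _∸_ ∸-computable p q))
          (CE-∘ CE-zero (∘₂-computable _∸_ ∸-computable q p)))

-- A recursion whose step runs c on the parameter diverges exactly when it has
-- a step to run and c diverges; this avoids dovetailing the disjunction.
CE-zero-⊎ : ∀ {P : Pred ℕ 0ℓ} {f} → Computable f → CE P → CE (λ x → f x ≡ 0 ⊎ P x)
CE-zero-⊎ {P} {f} p (c , P⊆c , c⊆P) =
  comp r (proj₁ q) ,
  (λ { {x} (inj₁ eq) → halts (subst (λ n → dom r ⟨ x , n ⟩) (sym eq) (0 , rec⇓₀ {a = x} zero⇓))
     ; {x} (inj₂ x∈P) → halts (steps (f x) (P⊆c x∈P)) }) ,
  (λ {x} d → inv refl (proj₂ (proj₂ (dom-comp r q) d)))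
  where
  q = ⟨⟩-computable id-computable p
  r = rec zero (comp c left)

  halts : ∀ {x} → dom r ⟨ x , f x ⟩ → dom (comp r (proj₁ q)) x
  halts = proj₁ (dom-comp r q)

  steps : ∀ {x} n → dom c x → dom r ⟨ x , n ⟩
  steps {x} zero _ = 0 , rec⇓₀ {a = x} zero⇓
  steps {x} (suc n) (y , e) = y , rec⇓₊ {a = x} (proj₂ (steps n (y , e)))
    (comp⇓ left⇓ (subst (λ z → c [ z ]⇓ y) (sym (π₁-⟨⟩ x ⟨ n , _ ⟩)) e))

  inv : ∀ {x z y} → z ≡ ⟨ x , f x ⟩ → r [ z ]⇓ y → f x ≡ 0 ⊎ P x
  inv {x} eq (rec⇓₀ {a = a} _) = inj₁ (sym (proj₂ (⟨⟩-injective {a} {0} {x} eq)))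
  inv {x} eq (rec⇓₊ {a = a} {n} {y} _ (comp⇓ left⇓ e)) = inj₂ (subst P
    (trans (π₁-⟨⟩ a ⟨ n , y ⟩) (proj₁ (⟨⟩-injective {a} {suc n} {x} eq))) (c⊆P (_ , e)))

-- Uniform indices

encode-numeral-computable : Computable (encode ∘ numeral)
encode-numeral-computable =
  Computable-resp fold-numeral
    (∘₂-computable (λ x → fold x succ-encode)
      (fold-computable
        (⟨⟩-computable (const-computable 5)
          (⟨⟩-computable (const-computable (encode succ)) id-computable)))
      (const-computable 0) id-computable)
  where
  succ-encode : ℕ → ℕ
  succ-encode e = ⟨ 5 , ⟨ encode succ , e ⟩ ⟩

  fold-numeral : ∀ n → fold 0 succ-encode n ≡ encode (numeral n)
  fold-numeral zero    = refl
  fold-numeral (suc n) = cong succ-encode (fold-numeral n)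

-- The parameter is hard-wired as a numeral into a program that forms `⟨ p , x ⟩` from `x` and then
-- runs the program for `R`.
s-m-n : {R : Pred ℕ 0ℓ} → CE R →
        ∃[ s ] Computable s × ∀ p → kleene (s p) ≐ λ x → ⟨ p , x ⟩ ∈ R
s-m-n {R} (c , R⊆c , c⊆R) = encode ∘ spec , spec-computable , λ p →
  (λ {x} x∈ → c⊆R (proj₂ (dom-comp c (graph p)) (proj₁ (kleene-encode (spec p)) x∈))) ,
  (λ {x} x∈ → proj₂ (kleene-encode (spec p)) (proj₁ (dom-comp c (graph p)) (R⊆c x∈)))
  where
  graph : ∀ p → Computable (λ x → ⟨ p , x ⟩)
  graph p = ⟨⟩-computable (const-computable p) id-computable

  spec : ℕ → Code
  spec p = comp c (proj₁ (graph p))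

  spec-computable : Computable (encode ∘ spec)
  spec-computable =
    -- The tags 5 and 4 are those of `comp` and `pair`; only the numeral varies with `p`.
    ⟨⟩-computable (const-computable 5)
      (⟨⟩-computable (const-computable (encode c))
        (⟨⟩-computable (const-computable 4)
          (⟨⟩-computable encode-numeral-computable
            (const-computable (encode (proj₁ id-computable))))))

uniform-index : ∀ {W} → IsStandard W → {R : Pred ℕ 0ℓ} → CE R →
                ∃[ g ] Computable g × ∀ p → W (g p) ≐ λ x → ⟨ p , x ⟩ ∈ R
uniform-index {W} (_ , h , h-computable , kleene≐) {R} R-CE = via-kleene (s-m-n R-CE)
  where
  via-kleene : (∃[ s ] Computable s × ∀ p → kleene (s p) ≐ λ x → ⟨ p , x ⟩ ∈ R) →
               ∃[ g ] Computable g × ∀ p → W (g p) ≐ λ x → ⟨ p , x ⟩ ∈ R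
  via-kleene (s , s-computable , s≐) = h ∘ s , ∘-computable h-computable s-computable ,
    λ p → ≐-trans {i = W (h (s p))} (≐-sym {x = kleene (s p)} (kleene≐ (s p))) (s≐ p)

-- Metrization

1/suc : ℕ → ℚ
1/suc k = mkℚ (ℤ.+ 1) k (1-coprimeTo (suc k))

1/suc-positive : ∀ k → 0ℚ ℚ.< 1/suc k
1/suc-positive k = ℚ.positive⁻¹ (1/suc k)

1/suc-antitone : ∀ {m n} → m ≤ n → 1/suc n ℚ.≤ 1/suc m
1/suc-antitone m≤n = *≤* (ℤ.*-monoˡ-≤-nonNeg (ℤ.+ 1) (ℤ.+≤+ (s≤s m≤n)))

-- A positive fraction is at least the reciprocal of its own denominator.
archimedean : ∀ {q} → 0ℚ ℚ.< q → ∃[ n ] 1/suc n ℚ.≤ q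
archimedean {mkℚ (ℤ.+ suc m) d _} _ =
  d , *≤* (ℤ.*-monoʳ-≤-nonNeg (ℤ.+ suc d) {ℤ.+ 1} {ℤ.+ suc m} (ℤ.+≤+ (s≤s z≤n)))
archimedean {mkℚ (ℤ.+ zero)  d _} (*<* (ℤ.+<+ ()))
archimedean {mkℚ ℤ.-[1+ m ]  d _} (*<* ())

fromℚ : ℚ → ℝ
ℝ.cut       (fromℚ r) = ℚ._< r
ℝ.inhabited (fromℚ r) = r ℚ.- 1ℚ , subst (r ℚ.- 1ℚ ℚ.<_) (ℚ.+-identityʳ r)
  (ℚ.+-monoʳ-< r (ℚ.negative⁻¹ (ℚ.- 1ℚ)))
ℝ.proper    (fromℚ r) = r , ℚ.<-irrefl refl
ℝ.lower     (fromℚ r) = ℚ.<-trans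
ℝ.open′     (fromℚ r) p<r with ℚ.<-dense p<r
... | q , p<q , q<r = q , p<q , q<r

module _ (em : ExcludedMiddle 0ℓ) (X : EffectiveSpace) where
  open EffectiveSpace X using (Carrier; _≈_; basic; basic-resp; Open)

  Separates : ℕ → Carrier → Carrier → Set
  Separates k x y = (x ∈ basic k × y ∉ basic k) ⊎ (y ∈ basic k × x ∉ basic k)

  -- The supremum of 1 / (k + 1) over the k whose basic open set separates x
  -- and y; the negative rationals make it 0 when there is none.
  dist : Carrier → Carrier → ℝ
  ℝ.cut       (dist x y) q = q ℚ.< 0ℚ ⊎ ∃[ k ] q ℚ.< 1/suc k × Separates k x y
  ℝ.inhabited (dist x y) = ℚ.- 1ℚ , inj₁ (ℚ.negative⁻¹ (ℚ.- 1ℚ))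
  ℝ.proper    (dist x y) = 1ℚ , λ where
    (inj₁ 1<0)           → ℚ.<-asym 1<0 (ℚ.positive⁻¹ 1ℚ)
    (inj₂ (k , 1<w , _)) →
      ℚ.<-irrefl refl (ℚ.<-≤-trans 1<w (1/suc-antitone z≤n))
  ℝ.lower     (dist x y) p<q (inj₁ q<0)           = inj₁ (ℚ.<-trans p<q q<0)
  ℝ.lower     (dist x y) p<q (inj₂ (k , q<w , s)) = inj₂ (k , ℚ.<-trans p<q q<w , s)
  ℝ.open′     (dist x y) (inj₁ p<0) with ℚ.<-dense p<0
  ... | q , p<q , q<0 = q , p<q , inj₁ q<0
  ℝ.open′     (dist x y) (inj₂ (k , p<w , s)) with ℚ.<-dense p<w
  ... | q , p<q , q<w = q , p<q , inj₂ (k , q<w , s)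

  Separates-split : ∀ {k x z} y → Separates k x z → Separates k x y ⊎ Separates k y z
  Separates-split {k} y s with em {y ∈ basic k}
  Separates-split y (inj₁ (x∈ , z∉)) | yes y∈ = inj₂ (inj₁ (y∈ , z∉))
  Separates-split y (inj₁ (x∈ , z∉)) | no  y∉ = inj₁ (inj₁ (x∈ , y∉))
  Separates-split y (inj₂ (z∈ , x∉)) | yes y∈ = inj₁ (inj₂ (y∈ , x∉))
  Separates-split y (inj₂ (z∈ , x∉)) | no  y∉ = inj₂ (inj₂ (z∈ , y∉))

  -- An index that separates the ends also separates `y` from one of them.
  dist-ultrametric : ∀ {x z q} y → q ∈ ℝ.cut (dist x z) →
                     q ∈ ℝ.cut (dist x y) ⊎ q ∈ ℝ.cut (dist y z)
  dist-ultrametric y (inj₁ q<0) = inj₁ (inj₁ q<0)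
  dist-ultrametric y (inj₂ (k , q<w , s)) =
    Sum.map (λ s → inj₂ (k , q<w , s)) (λ s → inj₂ (k , q<w , s)) (Separates-split y s)

  dist-symmetric : ∀ x y {q} → q ∈ ℝ.cut (dist x y) → q ∈ ℝ.cut (dist y x)
  dist-symmetric x y (inj₁ q<0)           = inj₁ q<0
  dist-symmetric x y (inj₂ (k , q<w , s)) = inj₂ (k , q<w , swap s)

  -- Some `p` above `r` lies in one of the two cuts, and the negative remainder `r - p` lies in the
  -- other, which contains all negative rationals.
  dist-triangular : ∀ x y z → dist x z ≤ᵣ dist x y +ᵣ dist y z
  dist-triangular x y z {r} r∈ with ℝ.open′ (dist x z) r∈
  ... | p , r<p , p∈ = split (dist-ultrametric y p∈)
    where
    r-p<0 : r ℚ.- p ℚ.< 0ℚ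
    r-p<0 = subst (r ℚ.- p ℚ.<_) (ℚ.+-inverseʳ p) (ℚ.+-monoˡ-< (ℚ.- p) r<p)

    r≡[r-p]+p : r ≡ r ℚ.- p ℚ.+ p
    r≡[r-p]+p = sym (trans (ℚ.+-assoc r (ℚ.- p) p)
      (trans (cong (r ℚ.+_) (ℚ.+-inverseˡ p)) (ℚ.+-identityʳ r)))

    split : p ∈ ℝ.cut (dist x y) ⊎ p ∈ ℝ.cut (dist y z) →
            r ∈ ℝ.cut (dist x y +ᵣ dist y z)
    split (inj₁ p∈) = p , r ℚ.- p , p∈ , inj₁ r-p<0 , trans r≡[r-p]+p (ℚ.+-comm _ p)
    split (inj₂ p∈) = r ℚ.- p , p , inj₁ r-p<0 , p∈ , r≡[r-p]+p

  -- The second hypothesis says that basic sets are closed. Agreement with a point on finitely many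
  -- indices is then an open condition, and such agreement bounds `dist`.
  zero-dimensional⇒metrizable :
    (∀ x y → (∀ k → x ∈ basic k ⇔ y ∈ basic k) → x ≈ y) →
    (∀ k x → x ∉ basic k → Σ[ ks ∈ List ℕ ] All (λ k → x ∈ basic k) ks ×
       (∀ {y} → All (λ k → y ∈ basic k) ks → y ∉ basic k)) →
    Metrizable X
  zero-dimensional⇒metrizable t₀ basic-closed = dist , isMetric , λ U →
    mk⇔ {A = Open U} {B = MetricOpen X dist U} (open⇒metricOpen U) (metricOpen⇒open U)
    where
    dist≃0⇒basic⊆ : ∀ {x y} → dist x y ≃ᵣ 0ᵣ → ∀ {k} → x ∈ basic k → y ∈ basic k
    dist≃0⇒basic⊆ (d≤0 , _) {k} x∈ = decidable-stable em λ y∉ →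
      ℚ.<-irrefl refl (d≤0 (inj₂ (k , 1/suc-positive k , inj₁ (x∈ , y∉))))

    ≈⇒dist≤0 : ∀ {x y} → x ≈ y → dist x y ≤ᵣ 0ᵣ
    ≈⇒dist≤0 x≈y (inj₁ q<0) = q<0
    ≈⇒dist≤0 x≈y (inj₂ (k , _ , inj₁ (x∈ , y∉))) =
      contradiction (basic-resp k x≈y x∈) y∉
    ≈⇒dist≤0 x≈y (inj₂ (k , _ , inj₂ (y∈ , x∉))) =
      contradiction (basic-resp k (EffectiveSpace.sym X x≈y) y∈) x∉

    isMetric : IsMetric X dist
    isMetric = record
      { nonneg     = λ x y → inj₁
      ; zero⇔≈     = λ x y → mk⇔
          (λ d≃0@(d≤0 , _) → t₀ x y λ k → mk⇔ (dist≃0⇒basic⊆ d≃0)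
             (dist≃0⇒basic⊆ ((λ q∈ → d≤0 (dist-symmetric y x q∈)) , inj₁)))
          (λ x≈y → ≈⇒dist≤0 x≈y , inj₁)
      ; symmetry   = λ x y → dist-symmetric x y , dist-symmetric y x
      ; triangular = dist-triangular
      }

    bound : List ℕ → ℕ
    bound []       = 0
    bound (k ∷ ks) = k ⊔ bound ks

    -- Separation by an index in the list would force a distance of at least `1/suc (bound ks)`.
    near : ∀ {x y q} ks → q ∉ ℝ.cut (dist x y) → q ℚ.< 1/suc (bound ks) →
           All (λ k → x ∈ basic k) ks → All (λ k → y ∈ basic k) ks
    near []       q∉ q<w []         = []
    near (k ∷ ks) q∉ q<w (x∈ ∷ x∈s) =
      decidable-stable em (λ y∉ → q∉ (inj₂
        (k , ℚ.<-≤-trans q<w (1/suc-antitone (ℕ.m≤m⊔n k (bound ks))) , inj₁ (x∈ , y∉)))) ∷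
      near ks q∉ (ℚ.<-≤-trans q<w (1/suc-antitone (ℕ.m≤n⊔m k (bound ks)))) x∈s

    open⇒metricOpen : ∀ U → Open U → MetricOpen X dist U
    open⇒metricOpen U U-open x∈U with U-open x∈U
    ... | ks , x∈ks , ks⊆U =
      fromℚ (1/suc (bound ks)) , (0ℚ , ℚ.<-irrefl refl , 1/suc-positive (bound ks)) ,
      λ (q , q∉ , q<w) → ks⊆U (near ks q∉ q<w x∈ks)

    -- Each index below `n` contributes either itself or a list that witnesses that the complement
    -- of its basic set is a neighbourhood of `x`.
    neighbourhood : ∀ n x → Σ[ ks ∈ List ℕ ] All (λ k → x ∈ basic k) ks ×
      (∀ {y} → All (λ k → y ∈ basic k) ks → ∀ k → k < n → ¬ Separates k x y)
    neighbourhood zero    x = [] , [] , λ _ _ ()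
    neighbourhood (suc n) x with neighbourhood n x | em {x ∈ basic n}
    ... | ks , x∈ks , agree | yes x∈n = n ∷ ks , x∈n ∷ x∈ks , λ where
      (y∈n ∷ y∈ks) k k<1+n s → Sum.[ (λ k<n → agree y∈ks k k<n s) , (λ where
        refl → Sum.[ (λ (_ , y∉) → y∉ y∈n) , (λ (_ , x∉) → x∉ x∈n) ] s) ]
        (ℕ.m<1+n⇒m<n∨m≡n k<1+n)
    ... | ks , x∈ks , agree | no x∉n with basic-closed n x x∉n
    ... | ls , x∈ls , disjoint = ks ++ ls , All.++⁺ x∈ks x∈ls , λ y∈ k k<1+n s →
      Sum.[ (λ k<n → agree (All.++⁻ˡ ks y∈) k k<n s) , (λ where
        refl → Sum.[ (λ (x∈ , _) → x∉n x∈) ,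
                     (λ (y∈n , _) → disjoint (All.++⁻ʳ ks y∈) y∈n) ] s) ]
        (ℕ.m<1+n⇒m<n∨m≡n k<1+n)

    metricOpen⇒open : ∀ U → MetricOpen X dist U → Open U
    metricOpen⇒open U U-open {x} x∈U with U-open x∈U
    ... | ε , (q , q≮0 , q∈ε) , ball⊆U with ℝ.open′ ε q∈ε
    -- The rational `q` may be 0; openness of the cut replaces it by a strictly positive `r`.
    ... | r , q<r , r∈ε with archimedean (ℚ.≤-<-trans (ℚ.≮⇒≥ q≮0) q<r)
    ... | n , w≤r with neighbourhood n x
    -- The witness is `r`: indices below `n` do not separate, and the others contribute at most
    -- `1/suc n`.
    ... | ks , x∈ks , agree = ks , x∈ks , λ y∈ks → ball⊆U (r , (λ where
      (inj₁ r<0) → q≮0 (ℚ.<-trans q<r r<0)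
      (inj₂ (k , r<w , s)) → Sum.[ (λ k<n → agree y∈ks k k<n s) ,
        (λ n≤k → ℚ.<-irrefl refl
           (ℚ.<-≤-trans r<w (ℚ.≤-trans (1/suc-antitone n≤k) w≤r))) ]
        (ℕ.<-≤-connex k n)) , r∈ε)

-- Strings and labels

-- The last entry is outermost, so this drops the last entry; it fixes the empty string 0, since
-- `unpair 0` is a pair of zeros.
tail : ℕ → ℕ
tail = π₂ ∘ pred

last : ℕ → ℕ
last = π₁ ∘ pred

last-∷ : ∀ a σ → last (suc ⟨ a , σ ⟩) ≡ a
last-∷ = π₁-⟨⟩

∷-injectiveʳ : ∀ a b {σ τ} → suc ⟨ a , σ ⟩ ≡ suc ⟨ b , τ ⟩ → σ ≡ τ
∷-injectiveʳ a b {σ} eq = proj₂ (⟨⟩-injective {a} {σ} {b} (ℕ.suc-injective eq))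

↾-cong : ∀ {f g} n → (∀ m → m < n → f m ≡ g m) → f ↾ n ≡ g ↾ n
↾-cong zero    eq = refl
↾-cong (suc n) eq = cong₂ (λ a σ → suc ⟨ a , σ ⟩)
  (eq n ℕ.≤-refl) (↾-cong n (λ m m<n → eq m (ℕ.m<n⇒m<1+n m<n)))

infixl 6 _[_≔_]

_[_≔_] : (ℕ → ℕ) → ℕ → ℕ → ℕ → ℕ
(f [ n ≔ a ]) m with m ℕ.≟ n
... | yes _ = a
... | no  _ = f m

≔-updates : ∀ f n a → (f [ n ≔ a ]) n ≡ a
≔-updates f n a with n ℕ.≟ n
... | yes _  = refl
... | no n≢n = contradiction refl n≢n

≔-minimal : ∀ f n a {m} → m < n → (f [ n ≔ a ]) m ≡ f m
≔-minimal f n a {m} m<n with m ℕ.≟ n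
... | yes m≡n = contradiction m≡n (ℕ.<⇒≢ m<n)
... | no  _   = refl

≔-↾ : ∀ f n a → (f [ n ≔ a ]) ↾ suc n ≡ suc ⟨ a , f ↾ n ⟩
≔-↾ f n a = cong₂ (λ a σ → suc ⟨ a , σ ⟩) (≔-updates f n a)
  (↾-cong n (λ _ → ≔-minimal f n a))

-- Complete induction on the code: removing the last entry of `suc x` leaves `π₂ x`, which is at
-- most `x`, and an update of the function restores that entry.
↾-surjective : ∀ σ → ∃₂ λ f n → f ↾ n ≡ σ
↾-surjective = <-rec _ build
  where
  π₂≤ : ∀ x → π₂ x ≤ x
  π₂≤ x = ℕ.≤-trans (ℕ.m≤n+m (π₂ x) _) (ℕ.≤-reflexive (pair-unpair x))

  extend : ∀ x → (∃₂ λ f n → f ↾ n ≡ π₂ x) → ∃₂ λ f n → f ↾ n ≡ suc x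
  extend x (f , n , eq) = f [ n ≔ π₁ x ] , suc n ,
    trans (≔-↾ f n (π₁ x))
      (cong suc (trans (cong ⟨ π₁ x ,_⟩ eq) (pair-unpair x)))

  build : ∀ σ → (∀ {τ} → τ < σ → ∃₂ λ f n → f ↾ n ≡ τ) → ∃₂ λ f n → f ↾ n ≡ σ
  build zero    _       = (λ _ → 0) , 0 , refl
  build (suc x) shorter = extend x (shorter (s≤s (π₂≤ x)))

↾-length : ∀ {f g} m n → f ↾ m ≡ g ↾ n → m ≡ n
↾-length zero    zero    _  = refl
↾-length {f} {g} (suc m) (suc n) eq =
  cong suc (↾-length m n (∷-injectiveʳ (f m) (g n) eq))

tail-↾ : ∀ f n → tail (f ↾ n) ≡ f ↾ pred n
tail-↾ f zero    = refl
tail-↾ f (suc n) = π₂-⟨⟩ (f n) (f ↾ n)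

tails-↾ : ∀ f n i → fold (f ↾ n) tail i ≡ f ↾ (n ∸ i)
tails-↾ f n zero    = refl
tails-↾ f n (suc i) = begin
  tail (fold (f ↾ n) tail i) ≡⟨ cong tail (tails-↾ f n i) ⟩
  tail (f ↾ (n ∸ i))         ≡⟨ tail-↾ f (n ∸ i) ⟩
  f ↾ pred (n ∸ i)           ≡⟨ cong (f ↾_) (ℕ.pred[m∸n]≡m∸[1+n] n i) ⟩
  f ↾ (n ∸ suc i)            ∎
  where open ≡-Reasoning

-- Nonzero exactly for a change from a positive label to 0, in the numerical form that `CE-zero-⊎`
-- takes.
cancel : ℕ → ℕ → ℕ
cancel i zero    = i
cancel i (suc _) = 0

cancel-same : ∀ i → cancel i i ≡ 0
cancel-same zero    = refl
cancel-same (suc _) = refl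

cancel-zero : ∀ j → cancel 0 j ≡ 0
cancel-zero zero    = refl
cancel-zero (suc _) = refl

cancel-positive : ∀ i {j} → 0 < j → cancel i j ≡ 0
cancel-positive i (s≤s _) = refl

cancel-computable : Computable₂ cancel
cancel-computable =
  Computable-resp (λ x → primrec-cancel (π₁ x) (π₂ x))
    (primrec-computable id-computable (const-computable 0))
  where
  primrec-cancel : ∀ i j → primrec id (λ _ → 0) i j ≡ cancel i j
  primrec-cancel i zero    = refl
  primrec-cancel i (suc _) = refl

tail-computable : Computable tail
tail-computable = ∘-computable π₂-computable pred-computable

last-computable : Computable last
last-computable = ∘-computable π₁-computable pred-computable

-- The one-step relation

module _ (A : Pred ℕ 0ℓ) where

  -- The element k stands for the string π₁ k with the label π₂ k.  A step
  -- appends one entry and may change the label freely, except that passing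
  -- from a label i > 0 to 0 needs the string shortened by i entries to be in A.
  data Step (p k l : ℕ) : Set where
    step : π₁ l ≡ suc ⟨ last (π₁ l) , π₁ k ⟩ →
           cancel (π₂ k) (π₂ l) ≡ 0 ⊎ ⟨ p , fold (π₁ k) tail (π₂ k) ⟩ ∈ A →
           Step p k l

  StepSet : Pred ℕ 0ℓ
  StepSet x = Step (π₁ x) (π₁ (π₂ x)) (π₂ (π₂ x))

  CE-StepSet : CE A → CE StepSet
  CE-StepSet A-CE = CE-resp
    ((λ (eq , guard) → step eq guard) , (λ { (step eq guard) → eq , guard }))
    (CE-∩
      (CE-≡ π₁l (∘-computable suc-computable
        (⟨⟩-computable (∘-computable last-computable π₁l) π₁k)))
      (CE-zero-⊎ (∘₂-computable cancel cancel-computable π₂k π₂l)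
        (CE-∘ A-CE (⟨⟩-computable π₁-computable
          (∘₂-computable (λ σ → fold σ tail) (fold-computable tail-computable) π₁k π₂k)))))
    where
    k-computable : Computable (π₁ ∘ π₂)
    k-computable = ∘-computable π₁-computable π₂-computable
    l-computable : Computable (π₂ ∘ π₂)
    l-computable = ∘-computable π₂-computable π₂-computable
    π₁k = ∘-computable π₁-computable k-computable
    π₂k = ∘-computable π₂-computable k-computable
    π₁l = ∘-computable π₁-computable l-computable
    π₂l = ∘-computable π₂-computable l-computable

  ∈-StepSet : ∀ p k l → StepSet ⟨ p , ⟨ k , l ⟩ ⟩ ≡ Step p k l
  ∈-StepSet p k l rewrite unpair-pair p ⟨ k , l ⟩ | unpair-pair k l = refl

-- Ideals of the transitive closure

module _ (A : Pred ℕ 0ℓ) (p : ℕ) {_≺_ : Rel.Rel ℕ 0ℓ}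
         (≺⇔ : _≺_ Rel.⇔ TransClosure (Step A p)) where
  open Ideal

  private
    _↝_ : Rel.Rel ℕ 0ℓ
    _↝_ = Step A p

    X : EffectiveSpace
    X = idealSpace _≺_

  ↝-∷ : ∀ a {k l σ} → π₁ k ≡ σ → π₁ l ≡ suc ⟨ a , σ ⟩ →
        cancel (π₂ k) (π₂ l) ≡ 0 ⊎ ⟨ p , fold (π₁ k) tail (π₂ k) ⟩ ∈ A → k ↝ l
  ↝-∷ a {k} {l} {σ} refl eq = step (trans eq (cong (λ b → suc ⟨ b , σ ⟩)
    (sym (trans (cong last eq) (last-∷ a σ)))))

  -- The label changes to that of `l` in the first step and then stays, so a single test of labels
  -- suffices.
  climb : ∀ {k l h m n} → π₁ k ≡ h ↾ m → π₁ l ≡ h ↾ n → m < n →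
          cancel (π₂ k) (π₂ l) ≡ 0 → TransClosure _↝_ k l
  climb {k} {l} {h} {m} {suc n} k≡ l≡ m<1+n c with ℕ.m<1+n⇒m<n∨m≡n m<1+n
  ... | inj₂ refl = [ ↝-∷ (h n) {k} {l} k≡ l≡ (inj₁ c) ]
  ... | inj₁ m<n  =
    climb {k} {k′} {h} k≡ π₁k′ m<n (trans (cong (cancel (π₂ k)) π₂k′) c) ∷ʳ
    ↝-∷ (h n) {k′} {l} π₁k′ l≡
      (inj₁ (trans (cong (λ i → cancel i (π₂ l)) π₂k′) (cancel-same (π₂ l))))
    where
    k′ = ⟨ h ↾ n , π₂ l ⟩
    π₁k′ = π₁-⟨⟩ (h ↾ n) (π₂ l)
    π₂k′ = π₂-⟨⟩ (h ↾ n) (π₂ l)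

  ↝-below : ∀ {k l h n} → k ↝ l → π₁ l ≡ h ↾ n →
            ∃[ m ] suc m ≡ n × π₁ k ≡ h ↾ m
  ↝-below {n = zero}  (step eq _) l≡ with () ← trans (sym eq) l≡
  ↝-below {l = l} {h} {suc n} (step eq _) l≡ =
    n , refl , ∷-injectiveʳ (last (π₁ l)) (h n) (trans (sym eq) l≡)

  below : ∀ {k l h n} → TransClosure _↝_ k l → π₁ l ≡ h ↾ n →
          ∃[ m ] m < n × π₁ k ≡ h ↾ m
  below {h = h} [ s ] l≡ with ↝-below {h = h} s l≡
  ... | m , refl , k≡ = m , ℕ.≤-refl , k≡
  below {h = h} (s ∷ ss) l≡ with below {h = h} ss l≡
  ... | n , n<N , k′≡ with ↝-below {h = h} s k′≡
  ... | m , refl , k≡ = m , ℕ.<-trans ℕ.≤-refl n<N , k≡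

  -- Every label in `P` may change freely to `j`, so a longer prefix of `h` with label `j` bounds
  -- any two members. The last argument makes the set lower.
  pathIdeal : (h : ℕ → ℕ) (P : Pred ℕ 0ℓ) (j : ℕ) → P j →
              (∀ {i} → P i → cancel i j ≡ 0) →
              (∀ {k l m} → π₁ k ≡ h ↾ m → k ↝ l → P (π₂ l) → P (π₂ k)) →
              Ideal _≺_
  members  (pathIdeal h P j Pj _ _) k = (∃[ m ] π₁ k ≡ h ↾ m) × P (π₂ k)
  nonempty (pathIdeal h P j Pj _ _) =
    ⟨ 0 , j ⟩ , (0 , π₁-⟨⟩ 0 j) , subst P (sym (π₂-⟨⟩ 0 j)) Pj
  lower    (pathIdeal h P j Pj _ P-lower) k≺l l∈ = lower⁺ (proj₁ ≺⇔ k≺l) l∈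
    where
    lower⁺ : ∀ {k l} → TransClosure _↝_ k l → (∃[ m ] π₁ l ≡ h ↾ m) × P (π₂ l) →
             (∃[ m ] π₁ k ≡ h ↾ m) × P (π₂ k)
    lower⁺ [ s ] ((n , l≡) , Pl) with ↝-below {h = h} s l≡
    ... | m , _ , k≡ = (m , k≡) , P-lower k≡ s Pl
    lower⁺ (s ∷ ss) l∈ = lower⁺ [ s ] (lower⁺ ss l∈)
  directed (pathIdeal h P j Pj P-top _) {k} {l} ((m , k≡) , Pk) ((n , l≡) , Pl) =
    top , ((suc (m ⊔ n) , π₁top) , subst P (sym π₂top) Pj) ,
    ≺top k≡ (s≤s (ℕ.m≤m⊔n m n)) Pk , ≺top l≡ (s≤s (ℕ.m≤n⊔m m n)) Pl
    where
    σ = h ↾ suc (m ⊔ n)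
    top = ⟨ σ , j ⟩
    π₁top = π₁-⟨⟩ σ j
    π₂top = π₂-⟨⟩ σ j

    ≺top : ∀ {k m′} → π₁ k ≡ h ↾ m′ → m′ < suc (m ⊔ n) → P (π₂ k) → k ≺ top
    ≺top {k} k≡ m′< Pk = proj₂ ≺⇔
      (climb {h = h} k≡ π₁top m′< (trans (cong (cancel (π₂ k)) π₂top) (P-top Pk)))

  -- `0 ≡ 0` admits every label, and label 1 works as the top since only changes to 0 are
  -- restricted.
  everywhere : (ℕ → ℕ) → Ideal _≺_
  everywhere h = pathIdeal h (λ _ → 0 ≡ 0) 1 refl (λ _ → refl) (λ _ _ _ → refl)

  -- No basic open set is empty, so a total program enumerates them all.
  overt : Overt X
  overt = zero , (λ _ → 0 , zero⇓) , λ {k} _ → through k (↾-surjective (π₁ k))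
    where
    through : ∀ k → (∃₂ λ h n → h ↾ n ≡ π₁ k) → ∃[ I ] k ∈ members I
    through k (h , n , eq) = everywhere h , (n , sym eq) , refl

  -- `I` lies strictly inside `J`, so each finite intersection of basic sets around `I` also
  -- contains `J`.
  ¬T₁ : ∀ f → f ∉ EffectiveOpen A p → ¬ T₁ X
  ¬T₁ f f∉ t₁ =
    let U , U-open , I∈U , J∉U = t₁ I J (λ (_ , J⊆I) → 1∉I (J⊆I {⟨ 0 , 1 ⟩} 1∈J))
        ks , I∈ks , ks⊆U       = U-open I∈U
    in J∉U (ks⊆U (All.map (λ (m , _) → m , refl) I∈ks))
    where
    unlabelled : ∀ {k l m} → π₁ k ≡ f ↾ m → k ↝ l → π₂ l ≡ 0 → π₂ k ≡ 0
    unlabelled {k} k≡ (step _ (inj₁ c)) l≡0 = subst (λ j → cancel (π₂ k) j ≡ 0) l≡0 c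
    unlabelled {k} {m = m} k≡ (step _ (inj₂ ∈A)) _ = contradiction
      -- The guard would put a prefix of `f`, namely `f ↾ m` without its last `π₂ k` entries, into
      -- `A`.
      (m ∸ π₂ k , subst (λ σ → ⟨ p , σ ⟩ ∈ A)
        (trans (cong (λ σ → fold σ tail (π₂ k)) k≡) (tails-↾ f m (π₂ k))) ∈A) f∉

    I J : Ideal _≺_
    I = pathIdeal f (_≡ 0) 0 refl id unlabelled
    J = everywhere f

    1∉I : ⟨ 0 , 1 ⟩ ∉ members I
    1∉I (_ , ())

    1∈J : ⟨ 0 , 1 ⟩ ∈ members J
    1∈J = (0 , refl) , refl

  module _ (I : Ideal _≺_) where

    lower⁺ : ∀ {k l} → TransClosure _↝_ k l → l ∈ members I → k ∈ members I
    lower⁺ ss = lower I (proj₂ ≺⇔ ss)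

    directed⁺ : ∀ {k l} → k ∈ members I → l ∈ members I →
                ∃[ u ] u ∈ members I × TransClosure _↝_ k u × TransClosure _↝_ l u
    directed⁺ k∈ l∈ with directed I k∈ l∈
    ... | u , u∈ , k≺u , l≺u = u , u∈ , proj₁ ≺⇔ k≺u , proj₁ ≺⇔ l≺u

    -- Directedness at `k` and `k` gives a member above; the first link of the chain to it is a
    -- member because ideals are lower.
    ascend : ∀ {k} → k ∈ members I → ∃[ l ] k ↝ l × l ∈ members I
    ascend k∈ with directed⁺ k∈ k∈
    ... | _ , u∈ , [ s ]    , _ = _ , s , u∈
    ... | _ , u∈ , (s ∷ ss) , _ = _ , s , lower⁺ ss u∈

    -- Label 0 may change freely to any label.
    unlabelled-below : ∀ {h m n k} → k ∈ members I → π₁ k ≡ h ↾ n → m < n →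
                       ⟨ h ↾ m , 0 ⟩ ∈ members I
    unlabelled-below {h} {m} {n} {k} k∈ k≡ m<n = lower⁺
      (climb {h = h} (π₁-⟨⟩ (h ↾ m) 0) k≡ m<n
        (trans (cong (λ i → cancel i (π₂ k)) (π₂-⟨⟩ (h ↾ m) 0)) (cancel-zero (π₂ k))))
      k∈

    unlabel : ∀ {k} → k ∈ members I → ⟨ π₁ k , 0 ⟩ ∈ members I
    -- The relation extends strings properly, so one goes up a step before coming down to label 0.
    unlabel {k} k∈ with ascend k∈
    ... | l , step l≡ _ , l∈ with ↾-surjective (π₁ k)
    ... | h , n , h≡ = subst (λ σ → ⟨ σ , 0 ⟩ ∈ members I)
      (trans (↾-cong n (λ _ → ≔-minimal h n a)) h≡)
      (unlabelled-below {h [ n ≔ a ]} {n} {suc n} l∈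
        (trans l≡ (trans (cong (λ σ → suc ⟨ a , σ ⟩) (sym h≡)) (sym (≔-↾ h n a))))
        ℕ.≤-refl)
      where a = last (π₁ l)

    root : ⟨ 0 , 0 ⟩ ∈ members I
    root with nonempty I
    ... | k , k∈ with ascend k∈
    ... | l , step l≡ _ , l∈ with ↾-surjective (π₁ l)
    ... | h , zero  , h≡ with () ← trans h≡ l≡
    ... | h , suc n , h≡ = unlabelled-below {h} {0} {suc n} l∈ (sym h≡) (s≤s z≤n)

    append : ∀ σ → ⟨ σ , 0 ⟩ ∈ members I → ∃[ a ] ⟨ suc ⟨ a , σ ⟩ , 0 ⟩ ∈ members I
    append σ σ∈ with ascend σ∈
    ... | l , step l≡ _ , l∈ = last (π₁ l) , subst (λ τ → ⟨ τ , 0 ⟩ ∈ members I)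
      (trans l≡ (cong (λ σ → suc ⟨ last (π₁ l) , σ ⟩) (π₁-⟨⟩ σ 0))) (unlabel l∈)

    -- Iterating `append` from `root` spells out an infinite path through the ideal.
    path : ∃[ f ] ∀ n → ⟨ f ↾ n , 0 ⟩ ∈ members I
    path = f , λ n → subst (λ σ → ⟨ σ , 0 ⟩ ∈ members I) (prefix≡ n) (proj₂ (prefix n))
      where
      prefix : ℕ → Σ[ σ ∈ ℕ ] ⟨ σ , 0 ⟩ ∈ members I
      prefix zero    = 0 , root
      prefix (suc n) =
        let σ , σ∈ = prefix n ; a , aσ∈ = append σ σ∈ in suc ⟨ a , σ ⟩ , aσ∈

      f : ℕ → ℕ
      f n = proj₁ (append (proj₁ (prefix n)) (proj₂ (prefix n)))

      prefix≡ : ∀ n → proj₁ (prefix n) ≡ f ↾ n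
      prefix≡ zero    = refl
      prefix≡ (suc n) = cong (λ σ → suc ⟨ f n , σ ⟩) (prefix≡ n)

    -- Beyond the prefix of the path that lies in A, the difference of the
    -- lengths is a label from which one may return to any label.
    relabel : (∀ f → f ∈ EffectiveOpen A p) →
              ∀ {k} l → π₁ k ≡ π₁ l → k ∈ members I → l ∈ members I
    relabel covered {k} l k≡l k∈ with path
    ... | f , f∈ with covered f
    ... | n , ∈A with directed⁺ k∈ (f∈ n)
    -- The detour `w` from `l` reuses the string of `u`, so a member `v` one entry longer is needed
    -- above it.
    ... | u , u∈ , k≺u , fn≺u with ascend u∈
    ... | v , step v≡ _ , v∈ with ↾-surjective (π₁ u)
    ... | g , N , g≡ with below {h = g} k≺u (sym g≡) | below {h = g} fn≺u (sym g≡)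
    ... | m , m<N , k≡ | n′ , n′<N , fn≡ = lower⁺ (climb {l} {w} {g} l≡ π₁w m<N
        (cancel-positive (π₂ l) (subst (0 <_) (sym π₂w) (ℕ.m<n⇒0<n∸m n′<N))) ∷ʳ
        ↝-∷ (last (π₁ v)) {w} {v} π₁w
          (trans v≡ (cong (λ σ → suc ⟨ last (π₁ v) , σ ⟩) (sym g≡)))
          (inj₂ (subst (λ σ → ⟨ p , σ ⟩ ∈ A) (sym shorten) ∈A))) v∈
      where
      w = ⟨ g ↾ N , N ∸ n′ ⟩
      π₁w = π₁-⟨⟩ (g ↾ N) (N ∸ n′)
      π₂w = π₂-⟨⟩ (g ↾ N) (N ∸ n′)
      l≡ = trans (sym k≡l) k≡

      open ≡-Reasoning
      shorten : fold (π₁ w) tail (π₂ w) ≡ f ↾ n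
      shorten = begin
        fold (π₁ w) tail (π₂ w)       ≡⟨ cong₂ (λ σ → fold σ tail) π₁w π₂w ⟩
        fold (g ↾ N) tail (N ∸ n′)    ≡⟨ tails-↾ g N (N ∸ n′) ⟩
        g ↾ (N ∸ (N ∸ n′))            ≡⟨ cong (g ↾_) (ℕ.m∸[m∸n]≡n (ℕ.<⇒≤ n′<N)) ⟩
        g ↾ n′                        ≡⟨ sym fn≡ ⟩
        π₁ ⟨ f ↾ n , 0 ⟩              ≡⟨ π₁-⟨⟩ (f ↾ n) 0 ⟩
        f ↾ n                         ∎

  -- Take the prefix of the path of `I` that is as long as the string of `k`. If both lie in one
  -- ideal, a common upper bound makes the strings equal, and `relabel` puts `k` into `I`.
  basic-closed : (∀ f → f ∈ EffectiveOpen A p) → (I : Ideal _≺_) → ∀ k → k ∉ members I →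
    ∃[ l ] l ∈ members I × ∀ (J : Ideal _≺_) → l ∈ members J → k ∉ members J
  basic-closed covered I k k∉ with path I | ↾-surjective (π₁ k)
  ... | f , f∈ | h , n , h≡ = ⟨ f ↾ n , 0 ⟩ , f∈ n , disjoint
    where
    disjoint : (J : Ideal _≺_) → ⟨ f ↾ n , 0 ⟩ ∈ members J → k ∉ members J
    disjoint J l∈ k∈ with directed⁺ J l∈ k∈
    ... | u , _ , l≺u , k≺u with ↾-surjective (π₁ u)
    ... | g , N , g≡ with below {h = g} l≺u (sym g≡) | below {h = g} k≺u (sym g≡)
    ... | m , _ , l≡ | m′ , _ , k≡
      with refl ← ↾-length {f} {g} n m (trans (sym (π₁-⟨⟩ (f ↾ n) 0)) l≡)
         | refl ← ↾-length {h} {g} n m′ (trans h≡ k≡)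
      = k∉ (relabel I covered k (trans l≡ (sym k≡)) (f∈ n))

  metrizable : ExcludedMiddle 0ℓ → (∀ f → f ∈ EffectiveOpen A p) → Metrizable X
  metrizable em covered = zero-dimensional⇒metrizable em X
    (λ I J I⇔J → (λ {k} → Equivalence.to (I⇔J k)) , (λ {k} → Equivalence.from (I⇔J k)))
    (λ k I k∉ → let l , l∈ , disjoint = basic-closed covered I k k∉ in
      (l ∷ []) , (l∈ ∷ []) , λ { {J} (l∈J ∷ []) → disjoint J l∈J })

-- Assembling the uniform family

TransClosure-map : ∀ {a ℓ₁ ℓ₂} {B : Set a} {R : Rel.Rel B ℓ₁} {S : Rel.Rel B ℓ₂} →
                   R Rel.⇒ S → TransClosure R Rel.⇒ TransClosure S
TransClosure-map R⇒S [ r ]    = [ R⇒S r ]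
TransClosure-map R⇒S (r ∷ rs) = R⇒S r ∷ TransClosure-map R⇒S rs

theorem25 : ExcludedMiddle 0ℓ →
    (W : ℕ → Pred ℕ 0ℓ) → IsStandard W →
    (t : ℕ → ℕ) → Computable t → IsTransitiveClosureMap W t →
    (F : Pred ℕ 0ℓ) → Π¹₁ F →
    ∃[ g ] Computable g ×
    (∀ p → Overt (ι W t (g p)) ×
    (p ∈ F → Metrizable (ι W t (g p))) ×
    (p ∉ F → ¬ T₁ (ι W t (g p))))
theorem25 em W standard t _ closure F (A , A-CE , F⊆ , ⊆F) = construct
  (uniform-index standard (CE-StepSet A A-CE))
  where
  construct : (∃[ g ] Computable g × ∀ p → W (g p) ≐ λ x → ⟨ p , x ⟩ ∈ StepSet A) → _
  construct (g , g-computable , g≐) = g , g-computable , λ p →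
    overt A p (≺⇔ p) ,
    (λ p∈F → metrizable A p (≺⇔ p) em (F⊆ p∈F)) ,
    (λ p∉F → let f , f∉ = uncovered p p∉F in ¬T₁ A p (≺⇔ p) f f∉)
    where
    ≺⇔ : ∀ p → V W (t (g p)) Rel.⇔ TransClosure (Step A p)
    ≺⇔ p =
      (λ k≺l → TransClosure-map
        (λ {k} {l} kl∈ → subst id (∈-StepSet A p k l) (proj₁ (g≐ p) kl∈))
        (proj₁ (closure (g p)) k≺l)) ,
      (λ k≺l → proj₂ (closure (g p)) (TransClosure-map
        (λ {k} {l} s → proj₂ (g≐ p) (subst id (sym (∈-StepSet A p k l)) s)) k≺l))

    -- Classically, a failure of the universal condition over paths yields a path that avoids `A`.
    uncovered : ∀ p → p ∉ F → ∃[ f ] f ∉ EffectiveOpen A p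
    uncovered p p∉F = decidable-stable em λ none →
      p∉F (⊆F λ f → decidable-stable em λ f∉ → none (f , f∉))
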